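{- There exists an absolute constant $c$ such that for every graph $G$ of treewidth at most $2$ and every pair of proper $5$-colorings $\alpha,\beta$ of $G$, there exists a transformation from $\alpha$ to $\beta$ (a sequence of proper $5$-colorings, each obtained from the previous one by changing the color of exactly one vertex) in which each vertex of $G$ is recolored at most $c$ times.
   Context: A proper $k$-coloring of $G$ is a map $\sigma:V(G)\to\{1,\dots,k\}$ with $\sigma(x)\neq\sigma(y)$ for every edge $xy$. Two $k$-colorings are adjacent if they differ on exactly one vertex; a transformation is a walk between colorings in this adjacency relation, and a vertex is recolored once at each step where its color changes. -}

module Defs where

open import Data.Bool using (if_then_else_)
open import Data.Fin using (Fin; _≟_)
open import Data.Fin.Subset using (Subset; _∈_; ∣_∣)
open import Data.List using (List; _∷_; length; _∷ʳ_)
open import Data.List.Relation.Unary.Linked using (Linked)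
open import Data.List.Relation.Unary.Unique.Propositional using (Unique)
open import Data.Nat using (ℕ; _+_; _∸_; _⊔_; _≤_)
open import Data.Product using (Σ; ∃; _×_)
open import Data.Vec.Functional using (foldr)
open import Level using (0ℓ)
open import Relation.Binary using (Rel; Decidable; Symmetric)
open import Relation.Binary.Construct.Closure.ReflexiveTransitive using (Star)
open import Relation.Binary.PropositionalEquality using (_≡_; _≢_; _≗_)
open import Relation.Nullary using (¬_; does)

record Graph (n : ℕ) : Set₁ where
  field
    Adj    : Rel (Fin n) 0ℓ
    adj?   : Decidable Adj
    sym    : Symmetric Adj
    irrefl : ∀ {x} → ¬ Adj x x

open Graph public using (Adj)

Connected : ∀ {n} → Graph n → Set
Connected G = ∀ x y → Star (Adj G) x y

-- The subgraph induced by P is connected (vacuously so if P is empty).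
ConnectedOn : ∀ {n} → Graph n → (Fin n → Set) → Set
ConnectedOn G P = ∀ {x y} → P x → P y →
  Star (λ a b → P a × P b × Adj G a b) x y

-- The cycle x, xs₁, …, xsₘ, x, with its base point repeated at the end.
record Cycle {n} (G : Graph n) : Set where
  field
    x        : Fin n
    xs       : List (Fin n)
    long     : 2 ≤ length xs
    distinct : Unique (x ∷ xs)
    closed   : Linked (Adj G) (x ∷ (xs ∷ʳ x))

record IsTree {n} (T : Graph n) : Set where
  field
    nonempty  : Fin n
    connected : Connected T
    acyclic   : ¬ Cycle T

record TreeDecomposition {n} (G : Graph n) : Set₁ where
  field
    size          : ℕ
    tree          : Graph size
    isTree        : IsTree tree
    bag           : Fin size → Subset n
    coversVertex  : ∀ v → ∃ λ t → v ∈ bag t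
    coversEdge    : ∀ {u v} → Adj G u v → ∃ λ t → u ∈ bag t × v ∈ bag t
    bagsConnected : ∀ v → ConnectedOn tree (λ t → v ∈ bag t)

-- Truncated subtraction differs from the usual max ∣bag∣ − 1 only when all
-- bags are empty (n = 0), where it gives 0 in place of −1.
width : ∀ {n} {G : Graph n} → TreeDecomposition G → ℕ
width D = foldr _⊔_ 0 (λ t → ∣ bag t ∣) ∸ 1
  where open TreeDecomposition D

-- Treewidth is the least width of a tree decomposition.
TreewidthAtMost : ∀ {n} → ℕ → Graph n → Set₁
TreewidthAtMost k G = Σ (TreeDecomposition G) λ D → width D ≤ k

record Coloring {n} (G : Graph n) (k : ℕ) : Set where
  field
    color  : Fin n → Fin k
    proper : ∀ {x y} → Adj G x y → color x ≢ color y

open Coloring public using (color)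

DifferAtExactlyOne : ∀ {n k} {G : Graph n} → Coloring G k → Coloring G k → Set
DifferAtExactlyOne σ τ = ∃ λ v →
  color σ v ≢ color τ v × (∀ w → w ≢ v → color σ w ≡ color τ w)

-- Colorings are functions, so the end of a walk is identified with its target
-- up to pointwise equality.
data Transformation {n k} {G : Graph n} : Coloring G k → Coloring G k → Set where
  done : ∀ {α β} → color α ≗ color β → Transformation α β
  step : ∀ {α β} (σ : Coloring G k) →
         DifferAtExactlyOne α σ → Transformation σ β → Transformation α β

recolorings : ∀ {n k} {G : Graph n} {α β : Coloring G k} →
              Transformation α β → Fin n → ℕ
recolorings (done _) v = 0
recolorings {α = α} (step σ _ T) v =
  (if does (color α v ≟ color σ v) then 0 else 1) + recolorings T v

{-# OPTIONS --safe #-}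

-- Give every vertex a timeline of colors. Treat vertices of a common bag that
-- start with the same color as one vertex; for the others record the history
-- of the pair, the interleaved sequence of their recolorings. Vertices are
-- added one at a time, each to a single vertex or to a pair with a common bag.
-- A new vertex only has to dodge the history of that pair, so it suffices to
-- find a finite family of histories, with at most 2 recolorings per vertex,
-- such that a third vertex with any initial color can be recolored to keep
-- both new histories in the family. One such family leads from 5 to 4 colors
-- and a second one from 4 to 3 colors; closure is checked exhaustively.
-- Finally, two 3-colorings are 3 recolorings per vertex apart, because two
-- classes of the target can be parked in the two unused colors.

module Submission where

open import Data.Bool using (Bool; true; false; _∧_; _∨_; not; if_then_else_; T)
open import Data.Bool.Properties using (T-∧; T-∨)
open import Data.Fin using (Fin; zero; suc; _≟_)
open import Data.Fin.Properties using (suc-injective; 0≢1+n)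
open import Data.Fin.Subset using (Subset; inside; outside; ∣_∣) renaming (_∈_ to _∈ₛ_)
open import Data.List using (List; []; _∷_; _++_; _∷ʳ_; length; map; filter; allFin)
import Data.List.Membership.DecPropositional as DecMembership
open import Data.List.Membership.Propositional using (_∈_; _∉_)
open import Data.List.Membership.Propositional.Properties using (∈-++⁺ˡ; ∈-++⁺ʳ; ∈-++⁻; ∈-map⁺; ∈-map⁻; ∈-filter⁺; ∈-filter⁻; ∈-allFin)
open import Data.List.Properties using (length-map)
open import Data.List.Relation.Binary.Subset.Propositional using (_⊆_)
open import Data.List.Relation.Unary.All using (All; []; _∷_)
import Data.List.Relation.Unary.All as All
open import Data.List.Relation.Unary.All.Properties using (¬Any⇒All¬; all-filter)
open import Data.List.Relation.Unary.AllPairs using ([]; _∷_)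
open import Data.List.Relation.Unary.Any using (here; there)
open import Data.List.Relation.Unary.Linked using (Linked; [-]; _∷_)
open import Data.List.Relation.Unary.Unique.Propositional using (Unique)
import Data.List.Relation.Unary.Unique.Propositional.Properties as Unique
open import Data.Nat using (ℕ; zero; suc; _+_; _⊔_; _≤_; z≤n; s≤s; s≤s⁻¹)
open import Data.Nat.Properties using (≤-refl; ≤-trans; ≤-reflexive; m≤m⊔n; m≤n⊔m; m≤m+n; m≤n+m∸n; +-suc; +-comm; +-assoc; +-identityʳ; +-mono-≤)
open import Data.Product using (∃; ∃₂; _×_; _,_; proj₁; proj₂)
open import Data.Sum using (_⊎_; inj₁; inj₂; swap) renaming (map to ⊎-map)
open import Data.Unit using (⊤; tt)
open import Data.Vec using (Vec; []; _∷_; head; tail; here; there)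
open import Data.Vec.Functional using (foldr; updateAt)
open import Data.Vec.Functional.Properties using (updateAt-updates; updateAt-minimal)
open import Defs
open import Function using (_∘_; const; case_of_; Equivalence)
open import Relation.Binary.Construct.Closure.ReflexiveTransitive using (Star; ε; _◅_; _◅◅_; gmap)
open import Relation.Binary.PropositionalEquality using (_≡_; _≢_; _≗_; refl; sym; trans; cong; cong₂; subst; subst₂; ≢-sym)
open import Relation.Nullary using (does; yes; no; contradiction)
open import Relation.Nullary.Decidable using (¬?; dec-true)
open import Relation.Unary using (Decidable)

Color : Set
Color = Fin 5

-- Boolean tests

infix 7 _==_ _/=_
infixr 4 _⇒_

_==_ _/=_ : ∀ {n} → Fin n → Fin n → Bool
zero  == zero  = true
zero  == suc _ = false
suc _ == zero  = false
suc x == suc y = x == y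
x /= y = not (x == y)

_⇒_ : Bool → Bool → Bool
false ⇒ _ = true
true  ⇒ b = b

∧-elim : ∀ a {b} → T (a ∧ b) → T a × T b
∧-elim a = Equivalence.to (T-∧ {a})

∧-intro : ∀ {a b} → T a → T b → T (a ∧ b)
∧-intro p q = Equivalence.from T-∧ (p , q)

⇒-elim : ∀ a {b} → T (a ⇒ b) → T a → T b
⇒-elim true p _ = p

-- Opaque, so that the exhaustive checks below are run only where unfolded.
opaque
  every some : ∀ {n} → (Fin n → Bool) → Bool
  every {zero}  P = true
  every {suc n} P = P zero ∧ every (P ∘ suc)
  some {zero}  P = false
  some {suc n} P = P zero ∨ some (P ∘ suc)

  every-elim : ∀ {n} (P : Fin n → Bool) → T (every P) → ∀ x → T (P x)
  every-elim P p zero    = proj₁ (∧-elim (P zero) p)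
  every-elim P p (suc x) = every-elim (P ∘ suc) (proj₂ (∧-elim (P zero) p)) x

  some-elim : ∀ {n} (P : Fin n → Bool) → T (some P) → ∃ λ x → T (P x)
  some-elim {suc n} P p with Equivalence.to (T-∨ {P zero}) p
  ... | inj₁ q = zero , q
  ... | inj₂ q = let x , r = some-elim (P ∘ suc) q in suc x , r

==-refl : ∀ {n} (x : Fin n) → (x == x) ≡ true
==-refl zero    = refl
==-refl (suc x) = ==-refl x

/=⇒≢ : ∀ {n} (x y : Fin n) → T (x /= y) → x ≢ y
/=⇒≢ x _ p refl rewrite ==-refl x = p

≢⇒/= : ∀ {n} (x y : Fin n) → x ≢ y → T (x /= y)
≢⇒/= zero    zero    x≢y = x≢y refl
≢⇒/= zero    (suc y) x≢y = _
≢⇒/= (suc x) zero    x≢y = _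
≢⇒/= (suc x) (suc y) x≢y = ≢⇒/= x y (λ { refl → x≢y refl })

-- Joint histories of two vertices

data Event : Set where
  left right : Color → Event

History : Set
History = List Event

Test : Set
Test = Color → Color → History → Bool

-- The arguments carry the current colors and the remaining recolorings of each vertex, so only
-- finitely many histories pass. A new color must also differ from the mover's own, which makes
-- every event a genuine recoloring.
within : (Color → Bool) → Color → Color → History → ℕ → ℕ → Bool
within K a b []            k       l       = K a ∧ K b
within K a b (left x ∷ s)  zero    l       = false
within K a b (left x ∷ s)  (suc k) l       = x /= a ∧ x /= b ∧ within K x b s k l
within K a b (right x ∷ s) k       zero    = false
within K a b (right x ∷ s) k       (suc l) = x /= b ∧ x /= a ∧ within K a x s k l

-- The third vertex is the right one in both of its joint histories, and keeping its color leaves no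
-- event.
move : Color → Color → History → History
move x y s = if x == y then s else right y ∷ s

-- A third vertex, of color x when the other two have colors a and b, is
-- recolored (to y, or not at all if x ≡ y) before each event of the history s
-- and once after the last one. The last two indices are the joint histories
-- of the left and of the right vertex with the third one.
data Insertion : Color → Color → Color → History → History → History → Set where
  done  : ∀ {a b x y} → y ≢ a → y ≢ b →
          Insertion a b x [] (move x y []) (move x y [])
  left  : ∀ {a b x y a′ s l r} → y ≢ a → y ≢ b → y ≢ a′ →
          Insertion a′ b y s l r →
          Insertion a b x (left a′ ∷ s) (move x y (left a′ ∷ l)) (move x y r)
  right : ∀ {a b x y b′ s l r} → y ≢ a → y ≢ b → y ≢ b′ →
          Insertion a b′ y s l r →
          Insertion a b x (right b′ ∷ s) (move x y l) (move x y (left b′ ∷ r))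

Found : Color → Color → Color → History → (History → History → Bool) → Set
Found a b x s P = ∃₂ λ l r → Insertion a b x s l r × T (P l r)

opaque
  -- Searches for an insertion with at most k recolorings whose histories pass P.
  search retry : ℕ → Color → Color → Color → History →
                 (History → History → Bool) → Bool
  slot : ℕ → Color → Color → Color → History →
         (History → History → Bool) → Color → Bool
  search k a b x s P = slot k a b x s P x ∨ retry k a b x s P
  retry zero    a b x s P = false
  retry (suc k) a b x s P = some λ y → y /= x ∧ slot k a b x s P y
  slot k a b x [] P y =
    y /= a ∧ y /= b ∧ P (move x y []) (move x y [])
  slot k a b x (left a′ ∷ s) P y =
    y /= a ∧ y /= b ∧ y /= a′ ∧
    search k a′ b y s λ l r → P (move x y (left a′ ∷ l)) (move x y r)
  slot k a b x (right b′ ∷ s) P y =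
    y /= a ∧ y /= b ∧ y /= b′ ∧
    search k a b′ y s λ l r → P (move x y l) (move x y (left b′ ∷ r))

  search-sound : ∀ k a b x s P → T (search k a b x s P) → Found a b x s P
  slot-sound   : ∀ k a b x s P y → T (slot k a b x s P y) → Found a b x s P
  search-sound k a b x s P p with Equivalence.to (T-∨ {slot k a b x s P x}) p
  ... | inj₁ q = slot-sound k a b x s P x q
  search-sound (suc k) a b x s P p | inj₂ q
    with some-elim (λ y → y /= x ∧ slot k a b x s P y) q
  ... | y , r = slot-sound k a b x s P y (proj₂ (∧-elim (y /= x) r))
  slot-sound k a b x [] P y p =
    let y/=a , q  = ∧-elim (y /= a) p
        y/=b , pr = ∧-elim (y /= b) q
    in _ , _ , done (/=⇒≢ y a y/=a) (/=⇒≢ y b y/=b) , pr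
  slot-sound k a b x (left a′ ∷ s) P y p =
    let y/=a  , q  = ∧-elim (y /= a) p
        y/=b  , q  = ∧-elim (y /= b) q
        y/=a′ , q  = ∧-elim (y /= a′) q
        _ , _ , i , pr = search-sound k a′ b y s _ q
    in _ , _ , left (/=⇒≢ y a y/=a) (/=⇒≢ y b y/=b) (/=⇒≢ y a′ y/=a′) i , pr
  slot-sound k a b x (right b′ ∷ s) P y p =
    let y/=a  , q  = ∧-elim (y /= a) p
        y/=b  , q  = ∧-elim (y /= b) q
        y/=b′ , q  = ∧-elim (y /= b′) q
        _ , _ , i , pr = search-sound k a b′ y s _ q
    in _ , _ , right (/=⇒≢ y a y/=a) (/=⇒≢ y b y/=b) (/=⇒≢ y b′ y/=b′) i , pr

-- Closed families of histories

opaque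
  -- The recursion mirrors `within`. `P` is composed with the events made so far, so it is always
  -- tested on whole histories.
  everyHistory everyLeft everyRight :
    (Color → Bool) → ℕ → ℕ → Color → Color → (History → Bool) → Bool
  everyHistory K k l a b P =
    ((K a ∧ K b) ⇒ P []) ∧ everyLeft K k l a b P ∧ everyRight K k l a b P
  everyLeft K zero    l a b P = true
  everyLeft K (suc k) l a b P = every λ x →
    (x /= a ∧ x /= b) ⇒ everyHistory K k l x b (P ∘ (left x ∷_))
  everyRight K k zero    a b P = true
  everyRight K k (suc l) a b P = every λ x →
    (x /= b ∧ x /= a) ⇒ everyHistory K k l a x (P ∘ (right x ∷_))

  everyHistory-elim : ∀ K k l a b P s → T (everyHistory K k l a b P) →
                      T (within K a b s k l) → T (P s)
  everyHistory-elim K k l a b P [] p w =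
    ⇒-elim (K a ∧ K b) (proj₁ (∧-elim ((K a ∧ K b) ⇒ P []) p)) w
  everyHistory-elim K (suc k) l a b P (left x ∷ s) p w =
    let p     = proj₂ (∧-elim ((K a ∧ K b) ⇒ P []) p)
        p     = proj₁ (∧-elim (everyLeft K (suc k) l a b P) p)
        p     = every-elim (λ x →
                  (x /= a ∧ x /= b) ⇒ everyHistory K k l x b (P ∘ (left x ∷_))) p x
        u , w = ∧-elim (x /= a) w
        v , w = ∧-elim (x /= b) w
    in everyHistory-elim K k l x b (P ∘ (left x ∷_)) s
         (⇒-elim (x /= a ∧ x /= b) p (∧-intro u v)) w
  everyHistory-elim K k (suc l) a b P (right x ∷ s) p w =
    let p     = proj₂ (∧-elim ((K a ∧ K b) ⇒ P []) p)
        p     = proj₂ (∧-elim (everyLeft K k (suc l) a b P) p)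
        p     = every-elim (λ x →
                  (x /= b ∧ x /= a) ⇒ everyHistory K k l a x (P ∘ (right x ∷_))) p x
        u , w = ∧-elim (x /= b) w
        v , w = ∧-elim (x /= a) w
    in everyHistory-elim K k l a x (P ∘ (right x ∷_)) s
         (⇒-elim (x /= b ∧ x /= a) p (∧-intro u v)) w

-- Only third colors distinct from `a` and `b` need a search: a vertex that shares its color with
-- one of the pair copies that timeline.
extends : (Color → Bool) → Test → Color → Color → History → Color → Bool
extends S good a b s c = S c ⇒ c /= a ⇒ c /= b ⇒
  search 2 a b c s λ l r → good a c l ∧ good b c r

closedAt : (S K : Color → Bool) → Test → Color → Color → Bool
closedAt S K good a b = (S a ∧ S b ∧ a /= b) ⇒
  everyHistory K 2 2 a b λ s → good a b s ⇒ every (extends S good a b s)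

closed : (S K : Color → Bool) → Test → Bool
closed S K good = every λ a → every (closedAt S K good a)

-- Initial colors satisfy S, final colors satisfy K.
record Scheme : Set where
  field
    S K      : Color → Bool
    good     : Test
    bounded  : ∀ a b s → T (good a b s) → T (within K a b s 2 2)
    isClosed : T (closed S K good)
    seed     : ∃₂ λ a b → T (S a) × T (S b) × a ≢ b × T (good a b [])

module _ (Ω : Scheme) where
  open Scheme Ω

  extension : ∀ {a b s} → T (S a) → T (S b) → a ≢ b → T (good a b s) →
              ∀ {c} → T (S c) → c ≢ a → c ≢ b →
              Found a b c s λ l r → good a c l ∧ good b c r
  extension {a} {b} {s} Sa Sb a≢b g {c} Sc c≢a c≢b =
    let p = every-elim (λ a → every (closedAt S K good a)) isClosed a
        p = every-elim (closedAt S K good a) p b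
        p = ⇒-elim (S a ∧ S b ∧ a /= b) p (∧-intro Sa (∧-intro Sb (≢⇒/= a b a≢b)))
        p = everyHistory-elim K 2 2 a b (λ s → good a b s ⇒ every (extends S good a b s)) s
              p (bounded a b s g)
        p = every-elim (extends S good a b s) (⇒-elim (good a b s) p g) c
        p = ⇒-elim (S c) p Sc
        p = ⇒-elim (c /= a) p (≢⇒/= c a c≢a)
        p = ⇒-elim (c /= b) p (≢⇒/= c b c≢b)
    in search-sound 2 a b c s (λ l r → good a c l ∧ good b c r) p

-- Timelines

private variable
  L : ℕ
  a b x : Color
  f g h : Vec Color L
  s     : History

-- The vectors list the colors after each step, at most one of the two vertices moving in a step.
-- Idle steps allow one common length for the timelines of all vertices.
data Trace : ∀ {L} → Color → Color → Vec Color L → Vec Color L → History → Set where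
  []    : Trace a b [] [] []
  stay  : Trace a b f g s → Trace a b (a ∷ f) (b ∷ g) s
  left  : x ≢ b → Trace x b f g s → Trace a b (x ∷ f) (b ∷ g) (left x ∷ s)
  right : x ≢ a → Trace a x f g s → Trace a b (a ∷ f) (x ∷ g) (right x ∷ s)

-- Slowing down by a factor of 2 makes room for a new vertex to move before
-- each step of the others, and once after the last one.
slowLength : ℕ → ℕ
slowLength zero    = 1
slowLength (suc n) = suc (suc (slowLength n))

slow : Color → Vec Color L → Vec Color (slowLength L)
slow a []      = a ∷ []
slow a (x ∷ f) = a ∷ x ∷ slow x f

slow-trace : Trace a b f g s → Trace a b (slow a f) (slow b g) s
slow-trace []          = stay []
slow-trace (stay t)    = stay (stay (slow-trace t))
slow-trace (left p t)  = stay (left p (slow-trace t))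
slow-trace (right p t) = stay (right p (slow-trace t))

move-trace : ∀ {y} → y ≢ a → Trace a y f h s → Trace a x (a ∷ f) (y ∷ h) (move x y s)
move-trace {x = x} {y = y} y≢a t with x ≟ y
... | yes refl rewrite ==-refl x = stay t
... | no x≢y with x == y | ≢⇒/= x y x≢y
...   | false | _ = right y≢a t

weave : ∀ {l r} → Trace a b f g s → Insertion a b x s l r →
        ∃ λ h → Trace a x (slow a f) h l × Trace b x (slow b g) h r
weave [] (done y≢a y≢b) = _ , move-trace y≢a [] , move-trace y≢b []
-- No event occurs here, so a pending move of the third vertex waits until the next one.
weave (stay t) i =
  let h , tl , tr = weave t i in _ , stay (stay tl) , stay (stay tr)
weave (left p t) (left y≢a y≢b y≢a′ i) =
  let h , tl , tr = weave t i
  in _ , move-trace y≢a (left (≢-sym y≢a′) tl) , move-trace y≢b (stay tr)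
weave (right p t) (right y≢a y≢b y≢b′ i) =
  let h , tl , tr = weave t i
  in _ , move-trace y≢a (stay tl) , move-trace y≢b (left (≢-sym y≢b′) tr)

change : Color → Color → ℕ
change a x = if does (a ≟ x) then 0 else 1

changes : Color → Vec Color L → ℕ
changes a []      = 0
changes a (x ∷ f) = change a x + changes x f

end : Color → Vec Color L → Color
end a []      = a
end a (x ∷ f) = end x f

change-refl : ∀ a → change a a ≡ 0
change-refl a rewrite dec-true (a ≟ a) refl = refl

change≤1 : ∀ a x → change a x ≤ 1
change≤1 a x with does (a ≟ x)
... | true  = z≤n
... | false = s≤s z≤n

Short : (Color → Bool) → ℕ → Color → Vec Color L → Set
Short K k a f = changes a f ≤ k × T (K (end a f))

stay-short : ∀ {K k a} (f : Vec Color L) → Short K k a f → Short K k a (a ∷ f)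
stay-short {a = a} f (p , q) rewrite change-refl a = p , q

move-short : ∀ {K k x} a (f : Vec Color L) → Short K k x f → Short K (suc k) a (x ∷ f)
move-short {x = x} a f (p , q) = +-mono-≤ (change≤1 a x) p , q

within-short : ∀ K k l → Trace a b f g s → T (within K a b s k l) →
               Short K k a f × Short K l b g
within-short K k l [] w = let Ka , Kb = ∧-elim _ w in (z≤n , Ka) , (z≤n , Kb)
within-short K k l (stay {f = f} {g = g} t) w =
  let p , q = within-short K k l t w in stay-short {K = K} f p , stay-short {K = K} g q
within-short {a = a} {b} K (suc k) l (left {x = x} {f = f} {g = g} _ t) w =
  let p , q = within-short K k l t (proj₂ (∧-elim (x /= b) (proj₂ (∧-elim (x /= a) w))))
  in move-short {K = K} a f p , stay-short {K = K} g q
within-short {a = a} {b} K k (suc l) (right {x = x} {f = f} {g = g} _ t) w =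
  let p , q = within-short K k l t (proj₂ (∧-elim (x /= a) (proj₂ (∧-elim (x /= b) w))))
  in stay-short {K = K} f p , move-short {K = K} b g q

-- Adjacent vertices with such timelines may perform each step in either order.
Strong : Color → Color → Vec Color L → Vec Color L → Set
Strong a b []      []      = ⊤
Strong a b (x ∷ f) (y ∷ g) = x ≢ b × a ≢ y × x ≢ y × Strong x y f g

strong-sym : ∀ a b (f g : Vec Color L) → Strong a b f g → Strong b a g f
strong-sym a b []      []      _ = _
strong-sym a b (x ∷ f) (y ∷ g) (p , q , r , t) =
  ≢-sym q , ≢-sym p , ≢-sym r , strong-sym x y f g t

-- Since one vertex stands still in each step, every mixture of old and new colors is the pair
-- before or the pair after the step.
trace-strong : a ≢ b → Trace a b f g s → Strong a b f g
trace-strong a≢b []          = _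
trace-strong a≢b (stay t)    = a≢b , a≢b , a≢b , trace-strong a≢b t
trace-strong a≢b (left p t)  = p , a≢b , p , trace-strong p t
trace-strong a≢b (right p t) = a≢b , ≢-sym p , ≢-sym p , trace-strong (≢-sym p) t

-- Words: timelines with their initial color

Word : ℕ → Set
Word L = Color × Vec Color L

slowWord : Word L → Word (slowLength L)
slowWord (a , f) = a , slow a f

module Words (Ω : Scheme) where
  open Scheme Ω

  -- Oriented, because `good` is not assumed symmetric in the two vertices; `Partners` forgets the
  -- orientation.
  data Compatible : ∀ {L} → Word L → Word L → Set where
    compatible : T (S a) → T (S b) → a ≢ b → Trace a b f g s → T (good a b s) →
                 Compatible (a , f) (b , g)

  Partners : Word L → Word L → Set
  Partners u v = Compatible u v ⊎ Compatible v u

  -- Equality is allowed because the construction joins all vertices of a bag, including nonadjacent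
  -- ones with the same initial color.
  Related : Word L → Word L → Set
  Related u v = u ≡ v ⊎ Partners u v

  related-sym : ∀ {u v : Word L} → Related u v → Related v u
  related-sym (inj₁ refl) = inj₁ refl
  related-sym (inj₂ p)    = inj₂ (swap p)

  slow-compatible : ∀ {u v : Word L} → Compatible u v → Compatible (slowWord u) (slowWord v)
  slow-compatible (compatible Sa Sb a≢b t p) = compatible Sa Sb a≢b (slow-trace t) p

  slow-partners : ∀ {u v : Word L} → Partners u v → Partners (slowWord u) (slowWord v)
  slow-partners (inj₁ p) = inj₁ (slow-compatible p)
  slow-partners (inj₂ p) = inj₂ (slow-compatible p)

  slow-related : ∀ {u v : Word L} → Related u v → Related (slowWord u) (slowWord v)
  slow-related (inj₁ refl) = inj₁ refl
  slow-related (inj₂ p)    = inj₂ (slow-partners p)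

  record Extension (u v : Word L) (c : Color) : Set where
    field
      timeline : Vec Color (slowLength L)
      partner  : ∃ (Partners (c , timeline))
      relatedˡ : Related (c , timeline) (slowWord u)
      relatedʳ : Related (c , timeline) (slowWord v)

  extend : ∀ {u v : Word L} → Compatible u v → ∀ c → T (S c) → Extension u v c
  extend {u = a , f} {b , g} p@(compatible Sa Sb a≢b t gd) c Sc with c ≟ a | c ≟ b
  -- The new vertex copies the timeline of the vertex with its color and inherits the partner.
  ... | yes refl | _ = record
    { timeline = slow a f ; partner = _ , slow-partners (inj₁ p)
    ; relatedˡ = inj₁ refl ; relatedʳ = slow-related (inj₂ (inj₁ p)) }
  ... | no _ | yes refl = record
    { timeline = slow b g ; partner = _ , slow-partners (inj₂ p)
    ; relatedˡ = slow-related (inj₂ (inj₂ p)) ; relatedʳ = inj₁ refl }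
  ... | no c≢a | no c≢b =
    let l , r , i , gds = extension Ω Sa Sb a≢b gd Sc c≢a c≢b
        h , tl , tr     = weave t i
        gl , gr         = ∧-elim (good a c l) gds
        pl = compatible Sa Sc (≢-sym c≢a) tl gl
        pr = compatible Sb Sc (≢-sym c≢b) tr gr
    in record { timeline = h ; partner = _ , inj₂ pl
              ; relatedˡ = inj₂ (inj₂ pl) ; relatedʳ = inj₂ (inj₂ pr) }

  extend-partners : ∀ {u v : Word L} → Partners u v → ∀ c → T (S c) → Extension u v c
  extend-partners (inj₁ p) c Sc = extend p c Sc
  extend-partners (inj₂ p) c Sc =
    record { timeline = timeline ; partner = partner
           ; relatedˡ = relatedʳ ; relatedʳ = relatedˡ }
    where open Extension (extend p c Sc)

  partner-short : ∀ {u v : Word L} → Partners u v → Short K 2 (proj₁ u) (proj₂ u)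
  partner-short (inj₁ (compatible _ _ _ t p)) = proj₁ (within-short K 2 2 t (bounded _ _ _ p))
  partner-short (inj₂ (compatible _ _ _ t p)) = proj₂ (within-short K 2 2 t (bounded _ _ _ p))

  related-strong : ∀ {u v : Word L} → proj₁ u ≢ proj₁ v → Related u v →
                   Strong (proj₁ u) (proj₁ v) (proj₂ u) (proj₂ v)
  related-strong u≢v (inj₁ refl) = contradiction refl u≢v
  related-strong u≢v (inj₂ (inj₁ (compatible _ _ p t _))) = trace-strong p t
  related-strong {u = a , f} {b , g} u≢v (inj₂ (inj₂ (compatible _ _ p t _))) =
    strong-sym b a g f (trace-strong p t)

-- From 5 to 4 colors and from 4 to 3 colors

pattern c₀ = zero
pattern c₁ = suc zero
pattern c₃ = suc (suc (suc zero))
pattern c₄ = suc (suc (suc (suc zero)))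

≤2 ≤3 ≤4 : Color → Bool
≤2 c = c /= c₃ ∧ c /= c₄
≤3 c = c /= c₄
≤4 _ = true

newColor : Event → Color
newColor (left x)  = x
newColor (right x) = x

-- Found by computer search: all histories with at most 2 recolorings per vertex
-- that end in ≤3 can be extended, except for some whose second and third new
-- colors differ from the initial and the first new colors, while the fourth
-- does not. Dropping all of the latter leaves a closed family.
tight : Test
tight a b (d ∷ e ∷ f ∷ g ∷ _) = fresh e ∧ fresh f ∧ not (fresh g)
  where
  fresh : Event → Bool
  fresh h = newColor h /= a ∧ newColor h /= b ∧ newColor h /= newColor d
tight a b _ = false

good₁ : Test
good₁ a b s = within ≤3 a b s 2 2 ∧ not (tight a b s)

lefts rights : History → List Color
lefts []             = []
lefts (left x ∷ s)   = x ∷ lefts s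
lefts (right _ ∷ s)  = lefts s
rights []            = []
rights (left _ ∷ s)  = rights s
rights (right x ∷ s) = x ∷ rights s

-- Moves at once to the final color, or from a color in ≤2 through c₄, which no
-- vertex has at the beginning, to another color in ≤2.
direct : Color → List Color → Bool
direct c (x ∷ y ∷ _) = x == c₄ ∧ y /= c ∧ c /= c₃
direct c _           = true

-- `good₂` is one pruning step towards the largest closed subfamily of `direct₂`; `closed₂` confirms
-- that a further step would remove nothing.
direct₂ good₂ : Test
direct₂ a b s = within ≤2 a b s 2 2 ∧ direct a (lefts s) ∧ direct b (rights s)
good₂ a b s   = direct₂ a b s ∧ every (extends ≤3 direct₂ a b s)

opaque
  unfolding every everyHistory search

  -- Checked by evaluation over all initial pairs, all histories within the budget and all third
  -- colors.
  closed₁ : T (closed ≤4 ≤3 good₁)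
  closed₁ = tt

  closed₂ : T (closed ≤3 ≤2 good₂)
  closed₂ = tt

  seed₂ : T (good₂ c₀ c₁ [])
  seed₂ = tt

scheme₁ scheme₂ : Scheme
scheme₁ = record
  { S = ≤4 ; K = ≤3 ; good = good₁
  ; bounded  = λ a b s p → proj₁ (∧-elim (within ≤3 a b s 2 2) p)
  ; isClosed = closed₁
  ; seed     = c₀ , c₁ , tt , tt , (λ ()) , tt }
scheme₂ = record
  { S = ≤3 ; K = ≤2 ; good = good₂
  ; bounded  = λ a b s p → proj₁ (∧-elim (within ≤2 a b s 2 2)
                                         (proj₁ (∧-elim (direct₂ a b s) p)))
  ; isClosed = closed₂
  ; seed     = c₀ , c₁ , tt , tt , (λ ()) , seed₂ }

-- Growing a tree

module _ {m} (T : Graph m) where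
  open DecMembership (_≟_ {m}) using (_∈?_)

  -- The newest node comes first and is a leaf: its parent `p` is its only neighbour among the
  -- earlier nodes.
  data Grow : List (Fin m) → Set where
    root : ∀ r → Grow (r ∷ [])
    grow : ∀ {y p ts} → y ∉ ts → p ∈ ts → Adj T y p →
           (∀ {q} → q ∈ ts → Adj T y q → q ≡ p) → Grow ts → Grow (y ∷ ts)

  grow-connected : ∀ {ts} → Grow ts → ConnectedOn T (_∈ ts)
  grow-connected (root r) (here refl) (here refl) = ε
  grow-connected (grow {y} {p} {ts} _ p∈ y~p _ γ) = walk
    where
    Step : List (Fin m) → Fin m → Fin m → Set
    Step ts a b = a ∈ ts × b ∈ ts × Adj T a b
    old : ∀ {a b} → a ∈ ts → b ∈ ts → Star (Step (y ∷ ts)) a b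
    old a∈ b∈ = gmap (λ x → x) (λ (a∈ , b∈ , e) → there a∈ , there b∈ , e)
                     (grow-connected γ a∈ b∈)
    walk : ConnectedOn T (_∈ y ∷ ts)
    walk (here refl) (here refl) = ε
    walk (here refl) (there b∈)  = (here refl , there p∈ , y~p) ◅ old p∈ b∈
    walk (there a∈)  (here refl) =
      old a∈ p∈ ◅◅ (there p∈ , here refl , Graph.sym T y~p) ◅ ε
    walk (there a∈)  (there b∈)  = old a∈ b∈

  data Path : Fin m → Fin m → List (Fin m) → Set where
    [_] : ∀ x → Path x x (x ∷ [])
    _∷_ : ∀ {x y z xs} → Adj T x y × x ∉ xs → Path y z xs → Path x z (x ∷ xs)

  suffix : ∀ {x y z xs} → x ∈ xs → Path y z xs → ∃ λ ys → Path x z ys × ys ⊆ xs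
  suffix (here refl) [ x ]     = _ , [ x ] , λ i → i
  suffix (here refl) (e ∷ π)   = _ , e ∷ π , λ i → i
  suffix (there x∈)  (e ∷ π)   = let ys , π′ , sub = suffix x∈ π in ys , π′ , there ∘ sub

  -- If the first node recurs on the erased rest of the walk, the path is restarted from that
  -- recurrence.
  loop-erase : ∀ {ts x z} → x ∈ ts → Star (λ a b → a ∈ ts × b ∈ ts × Adj T a b) x z →
               ∃ λ xs → Path x z xs × xs ⊆ ts
  loop-erase x∈ ε = _ , [ _ ] , λ { (here refl) → x∈ }
  loop-erase {x = x} x∈ ((_ , y∈ , x~y) ◅ w) with loop-erase y∈ w
  ... | xs , π , sub with x ∈? xs
  ...   | yes x∈xs = let ys , π′ , sub′ = suffix x∈xs π in ys , π′ , sub ∘ sub′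
  ...   | no  x∉xs = _ , (x~y , x∉xs) ∷ π , λ { (here refl) → x∈ ; (there i) → sub i }

  path-unique : ∀ {x z xs} → Path x z xs → Unique xs
  path-unique [ x ]            = [] ∷ []
  path-unique ((_ , x∉) ∷ π)   = ¬Any⇒All¬ _ x∉ ∷ path-unique π

  path-linked : ∀ {x z w y xs} → Adj T w x → Adj T z y → Path x z xs →
                Linked (Adj T) (w ∷ (xs ∷ʳ y))
  path-linked w~x z~y [ x ]           = w~x ∷ z~y ∷ [-]
  path-linked w~x z~y ((e , _) ∷ π) = w~x ∷ path-linked e z~y π

  path-long : ∀ {x z xs} → x ≢ z → Path x z xs → 2 ≤ length xs
  path-long x≢z [ x ]       = contradiction refl x≢z
  path-long x≢z (_ ∷ [ _ ]) = s≤s (s≤s z≤n)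
  path-long x≢z (_ ∷ _ ∷ _) = s≤s (s≤s z≤n)

  module _ (isTree : IsTree T) where
    open IsTree isTree

    -- Two distinct neighbours of `y` are linked by a simple path inside `ts`, which closes to a
    -- cycle through `y`.
    unique-neighbour : ∀ {ts y p q} → Grow ts → y ∉ ts → p ∈ ts → q ∈ ts →
                       Adj T y p → Adj T y q → q ≡ p
    unique-neighbour {y = y} {p} {q} γ y∉ p∈ q∈ y~p y~q with p ≟ q
    ... | yes p≡q = sym p≡q
    ... | no  p≢q =
      let xs , π , sub = loop-erase p∈ (grow-connected γ p∈ q∈)
      in contradiction (record
           { x        = y
           ; xs       = xs
           ; long     = path-long p≢q π
           ; distinct = ¬Any⇒All¬ xs (y∉ ∘ sub) ∷ path-unique π
           ; closed   = path-linked y~p (Graph.sym T y~q) π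
           }) acyclic

    -- Following the walk, each node not yet present is added as a leaf below its predecessor.
    reach : ∀ {ts x z} → Grow ts → x ∈ ts → Star (Adj T) x z →
            ∃ λ us → Grow us × ts ⊆ us × z ∈ us
    reach γ x∈ ε = _ , γ , (λ i → i) , x∈
    reach {ts} γ x∈ (_◅_ {j = y} x~y w) with y ∈? ts
    ... | yes y∈ = reach γ y∈ w
    ... | no  y∉ =
      let y~x = Graph.sym T x~y
          us , γ′ , sub , z∈ =
            reach (grow y∉ x∈ y~x (λ q∈ y~q → unique-neighbour γ y∉ x∈ q∈ y~x y~q) γ) (here refl) w
      in us , γ′ , sub ∘ there , z∈

    reach-all : ∀ zs → ∃ λ ts → Grow ts × nonempty ∈ ts × zs ⊆ ts
    reach-all []       = _ , root nonempty , here refl , λ ()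
    reach-all (z ∷ zs) =
      let ts , γ , r∈ , sub = reach-all zs
          us , γ′ , sub′ , z∈ = reach γ r∈ (connected nonempty z)
      in us , γ′ , sub′ r∈ , λ { (here refl) → z∈ ; (there i) → sub′ (sub i) }

  ConnectedWithin : (Fin m → Set) → List (Fin m) → Set
  ConnectedWithin P ts = ConnectedOn T (λ t → P t × t ∈ ts)

  -- A walk through y leaves it by the edge it came from, so y can be skipped.
  shrink : ∀ {P : Fin m → Set} {y p ts} → y ∉ ts → (∀ {q} → q ∈ ts → Adj T y q → q ≡ p) →
           ConnectedWithin P (y ∷ ts) → ConnectedWithin P ts
  shrink {P} {y} {p} {ts} y∉ only conn (Pa , a∈) (Pb , b∈) =
    avoid a∈ b∈ (conn (Pa , there a∈) (Pb , there b∈))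
    where
    Step : List (Fin m) → Fin m → Fin m → Set
    Step ts a b = (P a × a ∈ ts) × (P b × b ∈ ts) × Adj T a b
    avoid : ∀ {a b} → a ∈ ts → b ∈ ts → Star (Step (y ∷ ts)) a b → Star (Step ts) a b
    avoid a∈ b∈ ε = ε
    avoid a∈ b∈ (((Pa , _) , (Pc , there c∈) , a~c) ◅ w) =
      ((Pa , a∈) , (Pc , c∈) , a~c) ◅ avoid c∈ b∈ w
    avoid a∈ b∈ ((_ , (_ , here refl) , a~y) ◅ ε) = contradiction b∈ y∉
    avoid a∈ b∈ ((_ , (_ , here refl) , a~y) ◅ (_ , (_ , here refl) , y~y) ◅ _) =
      contradiction y~y (Graph.irrefl T)
    avoid a∈ b∈ ((_ , (_ , here refl) , a~y) ◅ (_ , (_ , there c∈) , y~c) ◅ w)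
      with refl ← trans (only a∈ (Graph.sym T a~y)) (sym (only c∈ y~c)) = avoid a∈ b∈ w

  -- The walk from `y` to `t` inside `P` must begin with the only edge out of `y`, the one to `p`.
  in-parent : ∀ {P : Fin m → Set} {y p t ts} → y ∉ ts → (∀ {q} → q ∈ ts → Adj T y q → q ≡ p) →
              ConnectedWithin P (y ∷ ts) → P y → P t → t ∈ ts → P p
  in-parent y∉ only conn Py Pt t∈ with conn (Py , here refl) (Pt , there t∈)
  ... | ε = contradiction t∈ y∉
  ... | (_ , (_ , here refl) , y~y) ◅ _ = contradiction y~y (Graph.irrefl T)
  ... | (_ , (Pc , there c∈) , y~c) ◅ _ with refl ← only c∈ y~c = Pc

-- Building a graph by attaching vertices to cliques

module _ {n : ℕ} where
  V : Set
  V = Fin n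

  Joined : List (V × V) → V → V → Set
  Joined es a b = (a , b) ∈ es ⊎ (b , a) ∈ es

  -- Two anchors must be joined, so that their timelines are already related when a new vertex has
  -- to respect both.
  data Anchor (vs : List V) (es : List (V × V)) : List V → Set where
    none : Anchor vs es []
    one  : ∀ {a} → a ∈ vs → Anchor vs es (a ∷ [])
    two  : ∀ {a b} → a ∈ vs → b ∈ vs → Joined es a b → Anchor vs es (a ∷ b ∷ [])

  data Build : List V → List (V × V) → Set where
    empty  : Build [] []
    attach : ∀ {v vs ds es} → v ∉ vs → Anchor vs es ds → Build vs es →
             Build (v ∷ vs) (map (v ,_) ds ++ es)

  Clique : List (V × V) → (V → Set) → Set
  Clique es P = ∀ {a b} → P a → P b → a ≢ b → Joined es a b

  anchor : ∀ {vs es} ds → Unique ds → ds ⊆ vs → Clique es (_∈ ds) →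
           length ds ≤ 2 → Anchor vs es ds
  anchor [] _ _ _ _ = none
  anchor (a ∷ []) _ sub _ _ = one (sub (here refl))
  anchor (a ∷ b ∷ []) ((a≢b ∷ []) ∷ _) sub clique _ =
    two (sub (here refl)) (sub (there (here refl))) (clique (here refl) (there (here refl)) a≢b)
  anchor (_ ∷ _ ∷ _ ∷ _) _ _ _ (s≤s (s≤s ()))

  record Enlarged (vs : List V) (es : List (V × V)) (ds zs : List V) : Set where
    field
      {vs′}  : List V
      {es′}  : List (V × V)
      build  : Build vs′ es′
      vs⊆    : vs ⊆ vs′
      zs⊆    : zs ⊆ vs′
      ⊆vs    : ∀ {v} → v ∈ vs′ → v ∈ zs ⊎ v ∈ vs
      es⊆    : ∀ {a b} → Joined es a b → Joined es′ a b
      clique : Clique es′ (λ v → v ∈ ds ⊎ v ∈ zs)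

  -- The new vertices `zs` of a bag are attached one by one, each to all of `ds` and then counted in
  -- `ds` itself.
  enlarge : ∀ {vs es} ds zs → Build vs es → Unique ds → ds ⊆ vs → Clique es (_∈ ds) →
            Unique zs → All (_∉ vs) zs → length ds + length zs ≤ 3 → Enlarged vs es ds zs
  enlarge ds [] B _ _ clique _ _ _ = record
    { build = B ; vs⊆ = λ i → i ; zs⊆ = λ () ; ⊆vs = inj₂ ; es⊆ = λ j → j
    ; clique = λ { (inj₁ a∈) (inj₁ b∈) → clique a∈ b∈ } }
  enlarge {vs} {es} ds (z ∷ zs) B uds ds⊆ clique (z≢ ∷ uzs) (z∉ ∷ zs∉) size = record
    { build  = E.build
    ; vs⊆    = E.vs⊆ ∘ there
    ; zs⊆    = λ { (here refl) → E.vs⊆ (here refl) ; (there i) → E.zs⊆ i }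
    ; ⊆vs    = λ i → case E.⊆vs i of λ
        { (inj₁ j)           → inj₁ (there j)
        ; (inj₂ (here refl)) → inj₁ (here refl)
        ; (inj₂ (there j))   → inj₂ j }
    ; es⊆    = E.es⊆ ∘ older
    ; clique = λ a∈ b∈ → E.clique (shift a∈) (shift b∈)
    }
    where
    size′ : suc (length ds + length zs) ≤ 3
    size′ = subst (_≤ 3) (+-suc (length ds) (length zs)) size
    older : ∀ {a b} → Joined es a b → Joined (map (z ,_) ds ++ es) a b
    older = ⊎-map (∈-++⁺ʳ (map (z ,_) ds)) (∈-++⁺ʳ (map (z ,_) ds))
    newer : ∀ {a} → a ∈ ds → (z , a) ∈ map (z ,_) ds ++ es
    newer a∈ = ∈-++⁺ˡ (∈-map⁺ (z ,_) a∈)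
    clique′ : Clique (map (z ,_) ds ++ es) (_∈ z ∷ ds)
    clique′ (here refl) (here refl) a≢b = contradiction refl a≢b
    clique′ (here refl) (there b∈)  _   = inj₁ (newer b∈)
    clique′ (there a∈)  (here refl) _   = inj₂ (newer a∈)
    clique′ (there a∈)  (there b∈)  a≢b = older (clique a∈ b∈ a≢b)
    ds⊆′ : z ∷ ds ⊆ z ∷ vs
    ds⊆′ (here refl) = here refl
    ds⊆′ (there i)   = there (ds⊆ i)
    zs∉′ : All (_∉ z ∷ vs) zs
    zs∉′ = All.zipWith
      (λ { (z≢x , x∉) (here x≡z) → z≢x (sym x≡z) ; (z≢x , x∉) (there x∈) → x∉ x∈ })
      (z≢ , zs∉)
    enlarged : Enlarged (z ∷ vs) (map (z ,_) ds ++ es) (z ∷ ds) zs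
    enlarged = enlarge (z ∷ ds) zs
      -- As `z` takes one of the three places in the bag, at most two anchors remain.
      (attach z∉ (anchor ds uds ds⊆ clique (≤-trans (m≤m+n _ _) (s≤s⁻¹ size′))) B)
      (¬Any⇒All¬ ds (z∉ ∘ ds⊆) ∷ uds) ds⊆′ clique′ uzs zs∉′ size′
    module E = Enlarged enlarged
    shift : ∀ {a} → a ∈ ds ⊎ a ∈ z ∷ zs → a ∈ z ∷ ds ⊎ a ∈ zs
    shift (inj₁ a∈)          = inj₁ (there a∈)
    shift (inj₂ (here refl)) = inj₁ (here refl)
    shift (inj₂ (there a∈))  = inj₂ a∈

-- Bags as lists

elements : ∀ {n} → Subset n → List (Fin n)
elements []            = []
elements (inside  ∷ p) = zero ∷ map suc (elements p)
elements (outside ∷ p) = map suc (elements p)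

length-elements : ∀ {n} (p : Subset n) → length (elements p) ≡ ∣ p ∣
length-elements []            = refl
length-elements (inside  ∷ p) = cong suc (trans (length-map suc (elements p)) (length-elements p))
length-elements (outside ∷ p) = trans (length-map suc (elements p)) (length-elements p)

∈-elements⁺ : ∀ {n} {p : Subset n} {x} → x ∈ₛ p → x ∈ elements p
∈-elements⁺ {p = inside  ∷ p} here       = here refl
∈-elements⁺ {p = inside  ∷ p} (there x∈) = there (∈-map⁺ suc (∈-elements⁺ x∈))
∈-elements⁺ {p = outside ∷ p} (there x∈) = ∈-map⁺ suc (∈-elements⁺ x∈)

∈-elements⁻ : ∀ {n} {p : Subset n} {x} → x ∈ elements p → x ∈ₛ p
∈-elements⁻ {p = inside  ∷ p} (here refl) = here
∈-elements⁻ {p = inside  ∷ p} (there x∈) with _ , y∈ , refl ← ∈-map⁻ suc x∈ = there (∈-elements⁻ y∈)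
∈-elements⁻ {p = outside ∷ p} x∈         with _ , y∈ , refl ← ∈-map⁻ suc x∈ = there (∈-elements⁻ y∈)

elements-unique : ∀ {n} (p : Subset n) → Unique (elements p)
elements-unique []            = []
elements-unique (inside  ∷ p) =
  ¬Any⇒All¬ _ (λ 0∈ → let _ , _ , 0≡ = ∈-map⁻ suc 0∈ in 0≢1+n 0≡)
  ∷ Unique.map⁺ suc-injective (elements-unique p)
elements-unique (outside ∷ p) = Unique.map⁺ suc-injective (elements-unique p)

foldr-⊔-≤ : ∀ {m} (f : Fin m → ℕ) t → f t ≤ foldr _⊔_ 0 f
foldr-⊔-≤ f zero    = m≤m⊔n _ _
foldr-⊔-≤ f (suc t) = ≤-trans (foldr-⊔-≤ (f ∘ suc) t) (m≤n⊔m _ _)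

length-filter-split : ∀ {A : Set} {P : A → Set} (P? : Decidable P) xs →
                      length (filter P? xs) + length (filter (¬? ∘ P?) xs) ≡ length xs
length-filter-split P? [] = refl
length-filter-split P? (x ∷ xs) with P? x
... | yes _ = cong suc (length-filter-split P? xs)
... | no  _ = trans (+-suc _ _) (cong suc (length-filter-split P? xs))

-- Covering the bags of a tree decomposition

module _ {n} {G : Graph n} (D : TreeDecomposition G) where
  open TreeDecomposition D
  open DecMembership (_≟_ {n}) using (_∈?_)

  -- `⊆bag` ensures that a vertex already present has a bag among the earlier nodes, from which a
  -- walk to a new bag can be taken.
  record Covering (ts : List (Fin size)) : Set where
    field
      {vs}   : List (Fin n)
      {es}   : List (Fin n × Fin n)
      build  : Build vs es
      bag⊆   : ∀ {t v} → t ∈ ts → v ∈ₛ bag t → v ∈ vs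
      ⊆bag   : ∀ {v} → v ∈ vs → ∃ λ t → t ∈ ts × v ∈ₛ bag t
      clique : ∀ {t} → t ∈ ts → Clique es (_∈ₛ bag t)

  module _ (bag≤3 : ∀ t → ∣ bag t ∣ ≤ 3) where

    cover-node : ∀ {ts} y (C : Covering ts) →
                 Clique (Covering.es C) (λ v → v ∈ₛ bag y × v ∈ Covering.vs C) →
                 Covering (y ∷ ts)
    cover-node y C clique-old = record
      { build  = E.build
      ; bag⊆   = λ { (here refl) v∈ → case sort v∈ of λ
                       { (inj₁ i) → E.vs⊆ (proj₂ (split-ds i)) ; (inj₂ i) → E.zs⊆ i }
                   ; (there t∈)  v∈ → E.vs⊆ (bag⊆ t∈ v∈) }
      ; ⊆bag   = λ v∈ → case E.⊆vs v∈ of λ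
          { (inj₁ i) → y , here refl , ∈-elements⁻ (proj₁ (∈-filter⁻ (¬? ∘ old) i))
          ; (inj₂ i) → let t , t∈ , v∈t = ⊆bag i in t , there t∈ , v∈t }
      ; clique = λ { (here refl) a∈ b∈ → E.clique (sort a∈) (sort b∈)
                   ; (there t∈)  a∈ b∈ a≢b → E.es⊆ (clique t∈ a∈ b∈ a≢b) }
      }
      where
      open Covering C
      old : Decidable (_∈ vs)
      old = _∈? vs
      us ds zs : List (Fin n)
      us = elements (bag y)
      ds = filter old us
      zs = filter (¬? ∘ old) us
      sort : ∀ {v} → v ∈ₛ bag y → v ∈ ds ⊎ v ∈ zs
      sort {v} v∈ with old v
      ... | yes o = inj₁ (∈-filter⁺ old (∈-elements⁺ v∈) o)
      ... | no ¬o = inj₂ (∈-filter⁺ (¬? ∘ old) (∈-elements⁺ v∈) ¬o)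
      split-ds : ∀ {v} → v ∈ ds → v ∈ₛ bag y × v ∈ vs
      split-ds i = let j , o = ∈-filter⁻ old i in ∈-elements⁻ j , o
      size≤3 : length ds + length zs ≤ 3
      size≤3 = ≤-trans
        (≤-reflexive (trans (length-filter-split old us) (length-elements (bag y)))) (bag≤3 y)
      enlarged : Enlarged vs es ds zs
      enlarged = enlarge ds zs build
        (Unique.filter⁺ old (elements-unique (bag y)))
        (proj₂ ∘ split-ds)
        (λ a∈ b∈ → clique-old (split-ds a∈) (split-ds b∈))
        (Unique.filter⁺ (¬? ∘ old) (elements-unique (bag y)))
        (all-filter (¬? ∘ old) us)
        size≤3
      module E = Enlarged enlarged

    -- The vertices of the new bag that are already present lie in the bag of the parent by
    -- `in-parent`, hence are pairwise joined.
    cover : ∀ {ts} → Grow tree ts →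
            (∀ v → ConnectedWithin tree (λ t → v ∈ₛ bag t) ts) → Covering ts
    cover (root r) _ = cover-node r
      record { build = empty ; bag⊆ = λ () ; ⊆bag = λ () ; clique = λ () }
      λ ()
    cover (grow {y} {p} y∉ p∈ y~p only γ) conn =
      cover-node y C λ (a∈ , a∈vs) (b∈ , b∈vs) → clique p∈ (up a∈ a∈vs) (up b∈ b∈vs)
      where
      C : Covering _
      C = cover γ λ v → shrink tree y∉ only (conn v)
      open Covering C
      up : ∀ {v} → v ∈ₛ bag y → v ∈ vs → v ∈ₛ bag p
      up {v} v∈ v∈vs = let t , t∈ , v∈t = ⊆bag v∈vs in in-parent tree y∉ only (conn v) v∈ v∈t t∈

-- The built graph may have more edges than `G`; the extra ones join vertices of a common bag.
record Constructed {n} (G : Graph n) : Set where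
  field
    {vs}     : List (Fin n)
    {es}     : List (Fin n × Fin n)
    build    : Build vs es
    spanning : ∀ v → v ∈ vs
    joins    : ∀ {x y} → Adj G x y → Joined es x y

construct : ∀ {n} {G : Graph n} → TreewidthAtMost 2 G → Constructed G
construct {G = G} (D , w≤2) = record
  { build    = C.build
  ; spanning = λ v → let t , v∈ = coversVertex v in C.bag⊆ (total t) v∈
  ; joins    = λ x~y → let t , x∈ , y∈ = coversEdge x~y in
      C.clique (total t) x∈ y∈ λ { refl → Graph.irrefl G x~y }
  }
  where
  open TreeDecomposition D
  ts : List (Fin size)
  ts = proj₁ (reach-all tree isTree (allFin size))
  grown : Grow tree ts
  grown = proj₁ (proj₂ (reach-all tree isTree (allFin size)))
  total : ∀ t → t ∈ ts
  total t = proj₂ (proj₂ (proj₂ (reach-all tree isTree (allFin size)))) (∈-allFin t)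
  connected : ∀ v → ConnectedWithin tree (λ t → v ∈ₛ bag t) ts
  connected v (a∈ , _) (b∈ , _) =
    gmap (λ t → t) (λ (a∈ , b∈ , e) → (a∈ , total _) , (b∈ , total _) , e)
         (bagsConnected v a∈ b∈)
  bag≤3 : ∀ t → ∣ bag t ∣ ≤ 3
  -- A number is at most 1 plus its truncated predecessor, so the truncation in `width` does no
  -- harm.
  bag≤3 t = ≤-trans (foldr-⊔-≤ (λ t → ∣ bag t ∣) t) (≤-trans (m≤n+m∸n _ 1) (s≤s w≤2))
  covering : Covering D ts
  covering = cover D bag≤3 grown connected
  module C = Covering covering

-- Timelines for all vertices

module Assign (Ω : Scheme) {n} (α : Fin n → Color) (Sα : ∀ v → T (Scheme.S Ω (α v))) where
  open Scheme Ω
  open Words Ω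

  -- A partner need not be the word of any vertex. It completes a single anchor, or two anchors with
  -- equal words, to a pair; `seeds` serves vertices without anchors.
  record Assignment (vs : List (Fin n)) (es : List (Fin n × Fin n)) : Set where
    field
      {len}    : ℕ
      timeline : Fin n → Vec Color len
    word : Fin n → Word len
    word v = α v , timeline v
    field
      seeds    : ∃₂ λ (u v : Word len) → Partners u v
      partner  : ∀ {v} → v ∈ vs → ∃ (Partners (word v))
      endpoints : ∀ {x y} → (x , y) ∈ es → x ∈ vs × y ∈ vs
      related  : ∀ {x y} → (x , y) ∈ es → Related (word x) (word y)

    joined-related : ∀ {x y} → Joined es x y → Related (word x) (word y)
    joined-related (inj₁ e) = related e
    joined-related (inj₂ e) = related-sym (related e)

  assign : ∀ {vs es} → Build vs es → Assignment vs es
  assign empty =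
    let a , b , Sa , Sb , a≢b , p = seed in record
    { timeline = λ _ → [] ; seeds = (a , []) , (b , []) , inj₁ (compatible Sa Sb a≢b [] p)
    ; partner = λ () ; endpoints = λ () ; related = λ () }
  assign {v ∷ vs} (attach {ds = ds} {es} v∉ A B) = record
    { timeline = timeline′
    ; seeds    = let _ , _ , p = seeds in _ , _ , slow-partners p
    ; partner  = partner′
    ; endpoints = endpoints′
    ; related  = related′
    }
    where
    open Assignment (assign B)

    anchored : ∀ {ds y} → Anchor vs es ds → y ∈ ds → y ∈ vs
    anchored (one a∈)      (here refl)         = a∈
    anchored (two a∈ _ _)  (here refl)         = a∈
    anchored (two _ b∈ _)  (there (here refl)) = b∈

    ends : ∀ {ds} → Anchor vs es ds →
           ∃₂ λ u w → Partners u w × (∀ {y} → y ∈ ds → word y ≡ u ⊎ word y ≡ w)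
    ends none = let u , w , p = seeds in u , w , p , λ ()
    ends (one a∈) = let w , p = partner a∈ in _ , w , p , λ { (here refl) → inj₁ refl }
    ends (two a∈ b∈ j) with joined-related j
    ... | inj₂ p = _ , _ , p , λ { (here refl) → inj₁ refl ; (there (here refl)) → inj₂ refl }
    ... | inj₁ a≡b = let w , p = partner a∈ in
      _ , w , p , λ { (here refl) → inj₁ refl ; (there (here refl)) → inj₁ (sym a≡b) }

    extended : Extension (proj₁ (ends A)) (proj₁ (proj₂ (ends A))) (α v)
    extended = extend-partners (proj₁ (proj₂ (proj₂ (ends A)))) (α v) (Sα v)
    module E = Extension extended

    to-anchor : ∀ {y} → y ∈ ds → Related (α v , E.timeline) (slowWord (word y))
    to-anchor y∈ with proj₂ (proj₂ (proj₂ (ends A))) y∈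
    ... | inj₁ eq = subst (λ u → Related (α v , E.timeline) (slowWord u)) (sym eq) E.relatedˡ
    ... | inj₂ eq = subst (λ u → Related (α v , E.timeline) (slowWord u)) (sym eq) E.relatedʳ

    slowed timeline′ : Fin n → Vec Color (slowLength len)
    slowed x  = slow (α x) (timeline x)
    timeline′ = updateAt slowed v (const E.timeline)

    word′ : Fin n → Word (slowLength len)
    word′ x = α x , timeline′ x

    new : word′ v ≡ (α v , E.timeline)
    new = cong (α v ,_) (updateAt-updates v slowed)

    old : ∀ {x} → x ∈ vs → word′ x ≡ slowWord (word x)
    old {x} x∈ = cong (α x ,_) (updateAt-minimal x v slowed λ { refl → v∉ x∈ })

    edge : ∀ {x y} → (x , y) ∈ map (v ,_) ds ++ es → (x ≡ v × y ∈ ds) ⊎ (x , y) ∈ es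
    edge e with ∈-++⁻ (map (v ,_) ds) e
    ... | inj₂ e∈ = inj₂ e∈
    ... | inj₁ e∈ with _ , y∈ , refl ← ∈-map⁻ (v ,_) e∈ = inj₁ (refl , y∈)

    partner′ : ∀ {x} → x ∈ v ∷ vs → ∃ (Partners (word′ x))
    partner′ (here refl) = subst (λ u → ∃ (Partners u)) (sym new) E.partner
    partner′ (there x∈)  = let w , p = partner x∈ in
      slowWord w , subst (λ u → Partners u (slowWord w)) (sym (old x∈)) (slow-partners p)

    endpoints′ : ∀ {x y} → (x , y) ∈ map (v ,_) ds ++ es → x ∈ v ∷ vs × y ∈ v ∷ vs
    endpoints′ e with edge e
    ... | inj₁ (refl , y∈) = here refl , there (anchored A y∈)
    ... | inj₂ e∈          = let x∈ , y∈ = endpoints e∈ in there x∈ , there y∈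

    related′ : ∀ {x y} → (x , y) ∈ map (v ,_) ds ++ es → Related (word′ x) (word′ y)
    related′ e with edge e
    ... | inj₁ (refl , y∈) = subst₂ Related (sym new) (sym (old (anchored A y∈))) (to-anchor y∈)
    ... | inj₂ e∈          = let x∈ , y∈ = endpoints e∈ in
      subst₂ Related (sym (old x∈)) (sym (old y∈)) (slow-related (related e∈))

-- Transformations

Reach : ∀ {n} {G : Graph n} → Coloring G 5 → Coloring G 5 → (Fin n → ℕ) → Set
Reach α β bound = ∃ λ (T : Transformation α β) → ∀ v → recolorings T v ≤ bound v

-- A transformation reaches its target only up to pointwise equality, so concatenation has to
-- transport the first step of the second walk.
done-then : ∀ {n} {G : Graph n} {α β γ : Coloring G 5} →
            color α ≗ color β → (T : Transformation β γ) →
            ∃ λ (T′ : Transformation α γ) → ∀ v → recolorings T′ v ≡ recolorings T v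
done-then p (done q) = done (λ v → trans (p v) (q v)) , λ _ → refl
done-then {α = α} p (step σ (v , d , same) T) =
  step σ (v , subst (_≢ color σ v) (sym (p v)) d , λ w w≢v → trans (p w) (same w w≢v)) T ,
  λ w → cong (λ c → change c (color σ w) + recolorings T w) (p w)

append : ∀ {n} {G : Graph n} {α β γ : Coloring G 5}
         (T : Transformation α β) (U : Transformation β γ) →
         ∃ λ (TU : Transformation α γ) →
           ∀ v → recolorings TU v ≡ recolorings T v + recolorings U v
append (done p)     U = done-then p U
append {α = α} (step σ d T) U = let TU , eq = append T U in
  step σ d TU , λ v → trans (cong (change (color α v) (color σ v) +_) (eq v))
                            (sym (+-assoc (change (color α v) (color σ v)) _ _))

change-sym : ∀ a b → change a b ≡ change b a
change-sym a b with a ≟ b | b ≟ a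
... | yes _   | yes _   = refl
... | no _    | no _    = refl
... | yes a≡b | no b≢a  = contradiction (sym a≡b) b≢a
... | no a≢b  | yes b≡a = contradiction (sym b≡a) a≢b

reverse : ∀ {n} {G : Graph n} {α β : Coloring G 5} (T : Transformation α β) →
          ∃ λ (U : Transformation β α) → ∀ v → recolorings U v ≡ recolorings T v
reverse (done p) = done (sym ∘ p) , λ _ → refl
reverse {α = α} (step σ (w , d , same) T) =
  let U , eq   = reverse T
      UU , eq′ = append U (step α (w , ≢-sym d , λ x x≢w → sym (same x x≢w)) (done λ _ → refl))
  in UU , λ v → trans (eq′ v) (trans (+-comm (recolorings U v) _)
       (cong₂ _+_ (trans (+-identityʳ _) (change-sym (color σ v) (color α v))) (eq v)))

reach-trans : ∀ {n} {G : Graph n} {α β γ : Coloring G 5} {k l} →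
              Reach α β k → Reach β γ l → Reach α γ (λ v → k v + l v)
reach-trans (T , p) (U , q) = let TU , eq = append T U in
  TU , λ v → ≤-trans (≤-reflexive (eq v)) (+-mono-≤ (p v) (q v))

reach-sym : ∀ {n} {G : Graph n} {α β : Coloring G 5} {k} → Reach α β k → Reach β α k
reach-sym (T , p) = let U , eq = reverse T in U , λ v → ≤-trans (≤-reflexive (eq v)) (p v)

-- Recoloring many vertices one after another

module _ {n} {G : Graph n} (σ τ : Coloring G 5)
         (compat : ∀ {x y} → Adj G x y → color σ x ≢ color τ y) where

  -- The list holds the vertices that may still wear their old color.
  Mixed : (Fin n → Color) → List (Fin n) → Set
  Mixed ρ vs = ∀ x → ρ x ≡ color τ x ⊎ (x ∈ vs × ρ x ≡ color σ x)

  mixed-proper : ∀ {ρ vs} → Mixed ρ vs → ∀ {x y} → Adj G x y → ρ x ≢ ρ y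
  mixed-proper M {x} {y} x~y with M x | M y
  ... | inj₁ p       | inj₁ q       = λ e → Coloring.proper τ x~y (trans (sym p) (trans e q))
  ... | inj₁ p       | inj₂ (_ , q) = λ e → compat (Graph.sym G x~y) (trans (sym q) (trans (sym e) p))
  ... | inj₂ (_ , p) | inj₁ q       = λ e → compat x~y (trans (sym p) (trans e q))
  ... | inj₂ (_ , p) | inj₂ (_ , q) = λ e → Coloring.proper σ x~y (trans (sym p) (trans e q))

  sweep-from : ∀ vs (ρ : Coloring G 5) → Mixed (color ρ) vs →
               Reach ρ τ λ v → change (color ρ v) (color τ v)
  sweep-from [] ρ M = done settled , λ _ → z≤n
    where
    settled : ∀ x → color ρ x ≡ color τ x
    settled x with inj₁ p ← M x = p
  sweep-from (v ∷ vs) ρ M with color ρ v ≟ color τ v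
  -- A step must change a color, so vertices that already agree with `τ` are skipped.
  ... | yes p = sweep-from vs ρ M′
    where
    M′ : Mixed (color ρ) vs
    M′ x with M x
    ... | inj₁ q                 = inj₁ q
    ... | inj₂ (here refl , _)   = inj₁ p
    ... | inj₂ (there x∈ , q)    = inj₂ (x∈ , q)
  ... | no d = step ρ′ (v , subst (color ρ v ≢_) (sym new) d , λ w w≢v → sym (old w≢v)) rest , count
    where
    recolored : Fin n → Color
    recolored = updateAt (color ρ) v (const (color τ v))
    new : recolored v ≡ color τ v
    new = updateAt-updates v (color ρ)
    old : ∀ {w} → w ≢ v → recolored w ≡ color ρ w
    old {w} w≢v = updateAt-minimal w v (color ρ) w≢v
    M′ : Mixed recolored vs
    M′ x with x ≟ v | M x
    ... | yes refl | _                     = inj₁ new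
    ... | no x≢v   | inj₁ q                = inj₁ (trans (old x≢v) q)
    ... | no x≢v   | inj₂ (here x≡v , _)   = contradiction x≡v x≢v
    ... | no x≢v   | inj₂ (there x∈ , q)   = inj₂ (x∈ , trans (old x≢v) q)
    ρ′ : Coloring G 5
    ρ′ = record { color = recolored ; proper = mixed-proper M′ }
    rest = proj₁ (sweep-from vs ρ′ M′)
    count : ∀ w → change (color ρ w) (recolored w) + recolorings rest w ≤ change (color ρ w) (color τ w)
    count w with w ≟ v | proj₂ (sweep-from vs ρ′ M′) w
    ... | yes refl | q rewrite new | change-refl (color τ w) =
      ≤-trans (+-mono-≤ (≤-refl {change (color ρ w) (color τ w)}) q) (≤-reflexive (+-identityʳ _))
    ... | no w≢v | q rewrite old w≢v | change-refl (color ρ w) = q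

  sweep : Reach σ τ λ v → change (color σ v) (color τ v)
  sweep = sweep-from (allFin n) σ λ x → inj₂ (∈-allFin x , refl)

-- Each position of the timelines is one sweep; `Strong` makes the order of the vertices within it
-- irrelevant.
follow : ∀ {n} {G : Graph n} {L} (α : Coloring G 5) (F : Fin n → Vec Color L) →
         (∀ {x y} → Adj G x y → Strong (color α x) (color α y) (F x) (F y)) →
         ∃ λ β → (∀ v → color β v ≡ end (color α v) (F v)) ×
                 Reach α β λ v → changes (color α v) (F v)
follow {L = zero} α F _ = α , ending , done (λ _ → refl) , λ _ → z≤n
  where
  ending : ∀ v → color α v ≡ end (color α v) (F v)
  ending v with [] ← F v = refl
follow {n} {G} {suc L} α F strong =
  let β , ending , T , count = follow α′ (tail ∘ F) (proj₂ ∘ proj₂ ∘ proj₂ ∘ strong′)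
      U , total = reach-trans (sweep α α′ (proj₁ ∘ proj₂ ∘ strong′)) (T , count)
  in β , (λ v → trans (ending v) (cong (end (color α v)) (sym (η (F v))))) ,
     U , λ v → ≤-trans (total v) (≤-reflexive (cong (changes (color α v)) (sym (η (F v)))))
  where
  η : (f : Vec Color (suc L)) → f ≡ head f ∷ tail f
  η (_ ∷ _) = refl
  strong′ : ∀ {x y} → Adj G x y →
    Strong (color α x) (color α y) (head (F x) ∷ tail (F x)) (head (F y) ∷ tail (F y))
  strong′ {x} {y} x~y = subst₂ (Strong _ _) (η (F x)) (η (F y)) (strong x~y)
  α′ : Coloring G 5
  α′ = record { color = head ∘ F ; proper = λ x~y → proj₁ (proj₂ (proj₂ (strong′ x~y))) }

module _ {n} {G : Graph n} (Ω : Scheme) (C : Constructed G) (α : Coloring G 5) where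
  open Scheme Ω
  open Words Ω
  open Constructed C

  -- Adjacent vertices start with distinct colors, so their related words are partners and satisfy
  -- `Strong`. The history of each vertex with its own partner gives the bound 2 and the final
  -- color.
  reduce : (∀ v → T (S (color α v))) →
           ∃ λ β → (∀ v → T (K (color β v))) × Reach α β (λ _ → 2)
  reduce Sα =
    let β , ending , U , count = follow α timeline λ x~y →
          related-strong (Coloring.proper α x~y) (joined-related (joins x~y))
    in β , (λ v → subst (T ∘ K) (sym (ending v)) (proj₂ (short v))) ,
       U , λ v → ≤-trans (count v) (proj₁ (short v))
    where
    open Assign Ω (color α) Sα
    open Assignment (assign build)
    short : ∀ v → Short K 2 (color α v) (timeline v)
    short v = partner-short (proj₂ (partner (spanning v)))

-- Exchanging two 3-colorings

-- The maps turn a source and a target color into an intermediate color; with distinct maps this is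
-- the condition for a sweep, with equal ones properness.
separated : (p q : Color → Color → Color) → Bool
separated p q = every λ g → every λ d → every λ g′ → every λ d′ →
  (≤2 g ∧ ≤2 d ∧ ≤2 g′ ∧ ≤2 d′ ∧ g /= g′ ∧ d /= d′) ⇒ p g d /= q g′ d′

-- First the classes with targets `c₀` and `c₁` move to the free colors `c₃` and `c₄`. Then only
-- vertices with the third target color are left in `≤2`, and they can take it at once.
park settle : Color → Color → Color
park g c₀ = c₃
park g c₁ = c₄
park g _  = g
settle _ c₀ = c₃
settle _ c₁ = c₄
settle _ d  = d

module _ {n} {G : Graph n} (γ δ : Coloring G 5)
         (γ≤2 : ∀ v → T (≤2 (color γ v))) (δ≤2 : ∀ v → T (≤2 (color δ v))) where

  apart : ∀ p q → T (separated p q) → ∀ {x y} → Adj G x y →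
          p (color γ x) (color δ x) ≢ q (color γ y) (color δ y)
  apart p q sep {x} {y} x~y =
    let s = every-elim _ sep (color γ x)
        s = every-elim _ s (color δ x)
        s = every-elim _ s (color γ y)
        s = every-elim _ s (color δ y)
    in /=⇒≢ _ _ (⇒-elim _ s
         (∧-intro (γ≤2 x) (∧-intro (δ≤2 x) (∧-intro (γ≤2 y) (∧-intro (δ≤2 y)
         (∧-intro (≢⇒/= _ _ (Coloring.proper γ x~y)) (≢⇒/= _ _ (Coloring.proper δ x~y))))))))

  combine : (p : Color → Color → Color) → T (separated p p) → Coloring G 5
  combine p sep = record { color = λ v → p (color γ v) (color δ v) ; proper = apart p p sep }

  opaque
    unfolding every
    exchange : Reach γ δ λ _ → 3
    exchange =
      -- With `every` unfolded, the checks left as underscores evaluate to the unit type.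
      let T , count = reach-trans (sweep γ ρ (apart (λ g _ → g) park _))
                     (reach-trans (sweep ρ τ (apart park settle _))
                                  (sweep τ δ (apart settle (λ _ d → d) _)))
      in T , λ v → ≤-trans (count v)
           (+-mono-≤ (change≤1 (color γ v) (color ρ v))
           (+-mono-≤ (change≤1 (color ρ v) (color τ v)) (change≤1 (color τ v) (color δ v))))
      where
      ρ τ : Coloring G 5
      ρ = combine park _
      τ = combine settle _

theorem1 : ∃ λ (c : ℕ) → ∀ (n : ℕ) (G : Graph n) → TreewidthAtMost 2 G → (α β : Coloring G 5) → ∃ λ (T : Transformation α β) → ∀ v → recolorings T v ≤ c
-- Two reductions of 2 recolorings from each end and 3 for the exchange: 4 + 3 + 4.
theorem1 = 11 , λ n G tw α β →
  let C = construct tw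
      α₁ , α₁≤3 , r₁ = reduce scheme₁ C α _
      α₂ , α₂≤2 , r₂ = reduce scheme₂ C α₁ α₁≤3
      β₁ , β₁≤3 , s₁ = reduce scheme₁ C β _
      β₂ , β₂≤2 , s₂ = reduce scheme₂ C β₁ β₁≤3
  in reach-trans (reach-trans r₁ r₂)
    (reach-trans (exchange α₂ β₂ α₂≤2 β₂≤2) (reach-sym (reach-trans s₁ s₂)))
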